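{- Let $A_n$ denote the set of permutations in $\mathcal{S}_n$ which avoid both patterns $213$ and $231$. For all $n\ge 1$, $$\sum_{\pi\in A_n}\mathrm{sign}(\pi)\,q^{\mathrm{lis}(\pi)}=q\,(q+1)^{\lfloor (n-1)/2\rfloor}(q-1)^{\lfloor n/2\rfloor}.$$ In particular, there are as many even as odd permutations in $A_n$.
   Context: $\mathcal{S}_n$ is the symmetric group on $\{1,\ldots,n\}$. A permutation $\pi\in\mathcal{S}_n$ (written in one-line notation $\pi_1\cdots\pi_n$) avoids the pattern $\tau\in\mathcal{S}_k$ if there is no sequence $1\le i_1<i_2<\cdots<i_k\le n$ such that $\pi_{i_1},\pi_{i_2},\ldots,\pi_{i_k}$ are in the same relative order as $\tau_1,\tau_2,\ldots,\tau_k$. Here $\mathrm{sign}(\pi)$ is the usual sign of $\pi$, $\mathrm{lis}(\pi)$ is the length of the longest increasing subsequence of $\pi_1\cdots\pi_n$, and $q$ is an indeterminate.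
   Formalization: The claim that there are as many even as odd permutations in A_n is proved for n ≥ 2 only; for n = 1 it is false, since A_1 consists of the identity alone. -}

module Defs where

open import Algebra.Bundles.Raw using (RawRing)
import Algebra.Definitions.RawSemiring
open import Data.Fin using (Fin; _<_; punchIn)
open import Data.Fin.Patterns using (0F; 1F; 2F)
open import Data.Fin.Permutation as Perm
  using (Permutation′; permutation; _⟨$⟩ʳ_; insert; insert-remove; remove)
open import Data.Fin.Properties using (_<?_; all?; any?; punchIn-injective)
open import Data.Integer as ℤ using (ℤ; 0ℤ; 1ℤ; -1ℤ)
import Data.Integer.Properties as ℤ
open import Data.List
  using (List; []; _∷_; _++_; map; foldr; filter; length; allFin; cartesianProduct; cartesianProductWith)
open import Data.List.Extrema.Nat using (max)
import Data.List.Membership.Setoid as Membership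
import Data.List.Membership.Setoid.Properties as Membershipₚ
import Data.List.Membership.Propositional.Properties as ∈ₚ
open import Data.List.Relation.Unary.All using ([])
open import Data.List.Relation.Unary.AllPairs using (allPairs?; []; _∷_)
open import Data.List.Relation.Unary.Any using (here)
import Data.List.Relation.Unary.Unique.Propositional.Properties as Uniqueₚ
open import Data.List.Relation.Unary.Unique.Setoid using (Unique)
import Data.List.Relation.Unary.Unique.Setoid.Properties as Uniqueₛ
open import Data.Nat using (ℕ; zero; suc)
open import Data.Product using (∃; _×_; _,_; uncurry)
open import Data.Vec using (Vec; []; _∷_; lookup)
import Data.Vec.Relation.Unary.Linked as Linked
open Linked using (Linked)
open import Function using (_⇔_; mk⇔; Equivalence)
open import Level using (0ℓ)
open import Relation.Binary.Bundles using (Setoid)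
open import Relation.Binary.PropositionalEquality
  using (_≡_; refl; sym; trans; cong; setoid)
open import Relation.Nullary using (Dec; ¬_; ¬?)
open import Relation.Nullary.Decidable using (map′; _×-dec_; _→-dec_)
open import Relation.Unary using (Pred; Decidable)

-- An element of ℤ[q]: the list a₀ ∷ a₁ ∷ a₂ ∷ … stands for a₀ + a₁ q + a₂ q² + …;
-- trailing zeros are allowed, so equality is equality of coefficients.

Poly : Set
Poly = List ℤ

coeff : Poly → ℕ → ℤ
coeff []      _       = 0ℤ
coeff (a ∷ p) zero    = a
coeff (a ∷ p) (suc k) = coeff p k

infix  4 _≈ₚ_
infixl 6 _+ₚ_ _-ₚ_
infixl 7 _*ₚ_
infix  8 -ₚ_

_≈ₚ_ : Poly → Poly → Set
p ≈ₚ r = ∀ k → coeff p k ≡ coeff r k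

_+ₚ_ : Poly → Poly → Poly
[]      +ₚ r       = r
(a ∷ p) +ₚ []      = a ∷ p
(a ∷ p) +ₚ (b ∷ r) = (a ℤ.+ b) ∷ (p +ₚ r)

-ₚ_ : Poly → Poly
-ₚ_ = map (ℤ.-_)

_-ₚ_ : Poly → Poly → Poly
p -ₚ r = p +ₚ (-ₚ r)

_*ₚ_ : Poly → Poly → Poly
[]      *ₚ r = []
(a ∷ p) *ₚ r = map (a ℤ.*_) r +ₚ (0ℤ ∷ (p *ₚ r))

const : ℤ → Poly
const a = a ∷ []

0ₚ 1ₚ q : Poly
0ₚ = []
1ₚ = const 1ℤ
q  = 0ℤ ∷ 1ℤ ∷ []

ℤ[q] : RawRing 0ℓ 0ℓ
ℤ[q] = record
  { Carrier = Poly
  ; _≈_     = _≈ₚ_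
  ; _+_     = _+ₚ_
  ; _*_     = _*ₚ_
  ; -_      = -ₚ_
  ; 0#      = 0ₚ
  ; 1#      = 1ₚ
  }

open Algebra.Definitions.RawSemiring (RawRing.rawSemiring ℤ[q]) public
  using () renaming (_^_ to _^ₚ_)

∑ₚ : {A : Set} → List A → (A → Poly) → Poly
∑ₚ xs f = foldr _+ₚ_ 0ₚ (map f xs)

-- The symmetric group is taken on Fin n = {0,…,n-1} instead of {1,…,n}.

Sym : ℕ → Setoid 0ℓ 0ℓ
Sym n = record
  { Carrier       = Permutation′ n
  ; _≈_           = Perm._≈_
  ; isEquivalence = record
    { refl  = λ _ → refl
    ; sym   = λ e i → sym (e i)
    ; trans = λ e f i → trans (e i) (f i)
    }
  }

-- Every permutation of Fin n, exactly once up to pointwise equality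
-- (∈-permutations and permutations-unique below).  The first entry j of
-- the one-line notation is chosen first.
permutations : ∀ n → List (Permutation′ n)
permutations zero    = Perm.id ∷ []
permutations (suc n) = cartesianProductWith (insert 0F) (allFin (suc n)) (permutations n)

private
  insert-cong : ∀ {n} {i j : Fin (suc n)} {π ρ : Permutation′ n} →
                i ≡ j → π Perm.≈ ρ → insert 0F i π Perm.≈ insert 0F j ρ
  insert-cong         refl e 0F          = refl
  insert-cong {i = i} refl e (Fin.suc k) = cong (punchIn i) (e k)

  insert-injective : ∀ {n} {i j : Fin (suc n)} {π ρ : Permutation′ n} →
                     insert 0F i π Perm.≈ insert 0F j ρ → i ≡ j × π Perm.≈ ρ
  insert-injective {i = i} e with e 0F
  ... | refl = refl , λ k → punchIn-injective i _ _ (e (Fin.suc k))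

∈-permutations : ∀ {n} (π : Permutation′ n) → Membership._∈_ (Sym n) π (permutations n)
∈-permutations {zero}  π = here λ ()
∈-permutations {suc n} π = Membershipₚ.∈-resp-≈ (Sym (suc n))
  {x = insert 0F (π ⟨$⟩ʳ 0F) (remove 0F π)} {y = π} (insert-remove 0F π)
  (Membershipₚ.∈-cartesianProductWith⁺ (setoid _) (Sym n) (Sym (suc n))
    (λ {i} {j} {π} {ρ} → insert-cong {i = i} {j} {π} {ρ})
    (∈ₚ.∈-allFin (π ⟨$⟩ʳ 0F)) (∈-permutations (remove 0F π)))

permutations-unique : ∀ n → Unique (Sym n) (permutations n)
permutations-unique zero    = [] ∷ []
permutations-unique (suc n) =
  Uniqueₛ.cartesianProductWith⁺ (setoid _) (Sym n) (Sym (suc n)) (insert 0F)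
    (λ {i} {j} {π} {ρ} → insert-injective {i = i} {j} {π} {ρ})
    (Uniqueₚ.allFin⁺ (suc n)) (permutations-unique n)

inversions : ∀ {n} → Permutation′ n → List (Fin n × Fin n)
inversions {n} π =
  filter (λ (i , j) → (i <? j) ×-dec ((π ⟨$⟩ʳ j) <? (π ⟨$⟩ʳ i)))
         (cartesianProduct (allFin n) (allFin n))

sign : ∀ {n} → Permutation′ n → ℤ
sign π = -1ℤ ℤ.^ length (inversions π)

even? : ∀ {n} → Decidable (λ (π : Permutation′ n) → sign π ≡ 1ℤ)
even? π = sign π ℤ.≟ 1ℤ

odd? : ∀ {n} → Decidable (λ (π : Permutation′ n) → sign π ≡ -1ℤ)
odd? π = sign π ℤ.≟ -1ℤ

oneLine : ∀ {n} → Permutation′ n → List (Fin n)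
oneLine π = map (π ⟨$⟩ʳ_) (allFin _)

subsequences : {A : Set} → List A → List (List A)
subsequences []       = [] ∷ []
subsequences (x ∷ xs) = map (x ∷_) (subsequences xs) ++ subsequences xs

lis : ∀ {n} → Permutation′ n → ℕ
lis π = max 0 (map length (filter (allPairs? _<?_) (subsequences (oneLine π))))

-- The entries of π at the positions i₁ < i₂ < ⋯ < iₖ are in the same
-- relative order as τ₁, τ₂, …, τₖ.
IsOccurrence : ∀ {k n} → Permutation′ k → Permutation′ n → Vec (Fin n) k → Set
IsOccurrence τ π is =
  Linked _<_ is ×
  (∀ a b → (π ⟨$⟩ʳ lookup is a) < (π ⟨$⟩ʳ lookup is b) ⇔ (τ ⟨$⟩ʳ a) < (τ ⟨$⟩ʳ b))

Avoids : ∀ {k n} → Permutation′ n → Permutation′ k → Set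
Avoids {k} {n} π τ = ¬ ∃ λ (is : Vec (Fin n) k) → IsOccurrence τ π is

private
  anyVec? : ∀ {n} k {P : Pred (Vec (Fin n) k) 0ℓ} → Decidable P → Dec (∃ P)
  anyVec? zero    P? = map′ ([] ,_) (λ { ([] , p) → p }) (P? [])
  anyVec? (suc k) P? =
    map′ (λ (x , xs , p) → x ∷ xs , p) (λ { (x ∷ xs , p) → x , xs , p })
         (any? λ x → anyVec? k λ xs → P? (x ∷ xs))

  _⇔-dec_ : {A B : Set} → Dec A → Dec B → Dec (A ⇔ B)
  a? ⇔-dec b? = map′ (uncurry mk⇔) (λ e → Equivalence.to e , Equivalence.from e)
                     ((a? →-dec b?) ×-dec (b? →-dec a?))

isOccurrence? : ∀ {k n} (τ : Permutation′ k) (π : Permutation′ n) → Decidable (IsOccurrence τ π)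
isOccurrence? τ π is =
  Linked.linked? _<?_ is ×-dec
  all? λ a → all? λ b →
    ((π ⟨$⟩ʳ lookup is a) <? (π ⟨$⟩ʳ lookup is b)) ⇔-dec ((τ ⟨$⟩ʳ a) <? (τ ⟨$⟩ʳ b))

avoids? : ∀ {k n} (π : Permutation′ n) (τ : Permutation′ k) → Dec (Avoids π τ)
avoids? π τ = ¬? (anyVec? _ (isOccurrence? τ π))

-- The one-line notations 213 and 231 read 1,0,2 and 1,2,0 on Fin 3; the
-- second vector is the inverse permutation.

[213] : Permutation′ 3
[213] = permutation (lookup (1F ∷ 0F ∷ 2F ∷ [])) (lookup (1F ∷ 0F ∷ 2F ∷ []))
  (λ { 0F → refl ; 1F → refl ; 2F → refl }) (λ { 0F → refl ; 1F → refl ; 2F → refl })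

[231] : Permutation′ 3
[231] = permutation (lookup (1F ∷ 2F ∷ 0F ∷ [])) (lookup (2F ∷ 0F ∷ 1F ∷ []))
  (λ { 0F → refl ; 1F → refl ; 2F → refl }) (λ { 0F → refl ; 1F → refl ; 2F → refl })

A : ∀ n → List (Permutation′ n)
A n = filter (λ π → avoids? π [213] ×-dec avoids? π [231]) (permutations n)

{-# OPTIONS --safe #-}

-- At every position of π ∈ Aₙ the later entries are all larger or all smaller:
-- a later smaller and a later larger entry would complete a 213 or a 231.  So
-- for n ≥ 1 the elements of Aₙ₊₁ arise from those of Aₙ by prepending a new
-- minimum or a new maximum.  The minimum keeps the sign and lengthens the
-- longest increasing subsequence by one; the maximum multiplies the sign by
-- (−1)ⁿ and keeps lis.  Hence the sum is multiplied by q + (−1)ⁿ.  As for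
-- the balance of signs: for n odd the two copies of Aₙ carry opposite signs, so
-- Aₙ₊₁ is balanced outright; for n even it inherits the balance of Aₙ.

module Submission where

open import Defs
open import Algebra.Bundles using (CommutativeSemigroup; CommutativeSemiring)
import Algebra.Properties.CommutativeSemigroup as CommutativeSemigroupProperties
open import Algebra.Structures using (IsCommutativeMonoid)
open import Algebra.Structures.Biased using (isCommutativeMonoidˡ; isCommutativeSemiringˡ)
open import Data.Bool using (true; false)
open import Data.Fin as Fin using (Fin; fromℕ; inject₁; punchIn; toℕ)
open import Data.Fin.Patterns using (0F; 1F; 2F)
open import Data.Fin.Permutation
  using (Permutation′; _⟨$⟩ʳ_; _⟨$⟩ˡ_; inverseˡ; inverseʳ; insert)
import Data.Fin.Properties as Fin
open import Data.Integer as ℤ using (ℤ; 0ℤ; 1ℤ; -1ℤ)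
import Data.Integer.Properties as ℤ
open import Data.List
  using (List; []; _∷_; _++_; _∷ʳ_; map; filter; length; tabulate; allFin; cartesianProduct; cartesianProductWith)
open import Data.List.Extrema.Nat using (max; max≈v⁺; xs≤max; argmax-sel)
open import Data.List.Membership.Propositional using (_∈_)
open import Data.List.Membership.Propositional.Properties
  using (∈-map⁺; ∈-filter⁺; ∈-++⁺ˡ; ∈-++⁺ʳ; ∈-tabulate⁻)
open import Data.List.Properties
  using ( map-∘; map-cong; map-id; map-++; map-tabulate; length-map; length-++; length-tabulate
        ; filter-++; filter-≐; filter-all; filter-none; ++-identityʳ
        ; cartesianProductWith-distribʳ-++)
open import Data.List.Relation.Unary.All as All using ([]; _∷_)
import Data.List.Relation.Unary.All.Properties as All
open import Data.List.Relation.Unary.AllPairs as AllPairs using (AllPairs; []; _∷_; allPairs?)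
import Data.List.Relation.Unary.AllPairs.Properties as AllPairs
open import Data.List.Relation.Unary.Any using (here)
open import Data.Nat using (ℕ; zero; suc; _≤_; _<_; _+_; _*_; _∸_; z≤n; s≤s; s<s; s<s⁻¹; z<s)
open import Data.Nat.Divisibility using (divides-refl)
open import Data.Nat.DivMod using (_/_; _divMod_; result; m*n/n≡m; +-distrib-/-∣ʳ)
open import Data.Nat.Properties using (+-comm; ≤-refl; ≤-trans; <⇒≤; m≤n⇒m≤1+n)
open import Data.Product using (∃; _×_; _,_; proj₁; proj₂; uncurry)
open import Data.Sum using (_⊎_; inj₁; inj₂; [_,_]′)
open import Data.Vec using (Vec; []; _∷_; lookup)
open import Data.Vec.Relation.Unary.Linked using (Linked; []; [-]; _∷_)
open import Function using (_∘_; id; mk⇔; Equivalence)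
open import Level using (0ℓ)
open import Relation.Binary.Bundles using (Setoid)
open import Relation.Binary.Definitions using (tri<; tri≈; tri>)
open import Relation.Binary.PropositionalEquality
  using (_≡_; _≢_; refl; sym; trans; cong; cong₂; subst; setoid; module ≡-Reasoning)
import Relation.Binary.Reasoning.Setoid as SetoidReasoning
open import Relation.Nullary using (¬_; does; contradiction)
open import Relation.Nullary.Decidable using (_×-dec_)
open import Relation.Unary using (Pred; Decidable; _≐_)

-- _≈ₚ_ unfolds to a function type, from which Agda cannot infer the
-- polynomials; the record keeps them visible to unification.
infix 4 _≋_
record _≋_ (p r : Poly) : Set where
  constructor coeffwise
  field at : p ≈ₚ r
open _≋_

-- Arithmetic of ℤ[q]

≋-setoid : Setoid 0ℓ 0ℓ
≋-setoid = record
  { Carrier       = Poly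
  ; _≈_           = _≋_
  ; isEquivalence = record
    { refl  = coeffwise λ _ → refl
    ; sym   = λ (coeffwise e) → coeffwise λ k → sym (e k)
    ; trans = λ (coeffwise e) (coeffwise f) → coeffwise λ k → trans (e k) (f k)
    }
  }

private
  module ≋ = Setoid ≋-setoid
  module ≋-Reasoning = SetoidReasoning ≋-setoid

scale : ℤ → Poly → Poly
scale a = map (a ℤ.*_)

coeff-+ₚ : ∀ p r k → coeff (p +ₚ r) k ≡ coeff p k ℤ.+ coeff r k
coeff-+ₚ []      r       k       = sym (ℤ.+-identityˡ _)
coeff-+ₚ (a ∷ p) []      k       = sym (ℤ.+-identityʳ _)
coeff-+ₚ (a ∷ p) (b ∷ r) zero    = refl
coeff-+ₚ (a ∷ p) (b ∷ r) (suc k) = coeff-+ₚ p r k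

coeff-scale : ∀ a p k → coeff (scale a p) k ≡ a ℤ.* coeff p k
coeff-scale a []      k       = sym (ℤ.*-zeroʳ a)
coeff-scale a (b ∷ p) zero    = refl
coeff-scale a (b ∷ p) (suc k) = coeff-scale a p k

∷-cong : ∀ {a b p r} → a ≡ b → p ≋ r → (a ∷ p) ≋ (b ∷ r)
∷-cong e f .at zero    = e
∷-cong e f .at (suc k) = f .at k

-- The recursion of `_*ₚ_` leaves trailing zeros behind; this removes them, and it is why several
-- laws of the product hold only coefficientwise and not as equalities of lists.
0∷[]≋0ₚ : (0ℤ ∷ []) ≋ 0ₚ
0∷[]≋0ₚ .at zero    = refl
0∷[]≋0ₚ .at (suc k) = refl

+ₚ-cong : ∀ {p p′ r r′} → p ≋ p′ → r ≋ r′ → (p +ₚ r) ≋ (p′ +ₚ r′)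
+ₚ-cong {p} {p′} {r} {r′} e f .at k = begin
  coeff (p +ₚ r) k            ≡⟨ coeff-+ₚ p r k ⟩
  coeff p k ℤ.+ coeff r k     ≡⟨ cong₂ ℤ._+_ (e .at k) (f .at k) ⟩
  coeff p′ k ℤ.+ coeff r′ k   ≡⟨ coeff-+ₚ p′ r′ k ⟨
  coeff (p′ +ₚ r′) k          ∎
  where open ≡-Reasoning

+ₚ-comm : ∀ p r → (p +ₚ r) ≡ (r +ₚ p)
+ₚ-comm []      []      = refl
+ₚ-comm []      (b ∷ r) = refl
+ₚ-comm (a ∷ p) []      = refl
+ₚ-comm (a ∷ p) (b ∷ r) = cong₂ _∷_ (ℤ.+-comm a b) (+ₚ-comm p r)

+ₚ-identityʳ : ∀ p → (p +ₚ 0ₚ) ≡ p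
+ₚ-identityʳ p = +ₚ-comm p 0ₚ

+ₚ-assoc : ∀ p r s → ((p +ₚ r) +ₚ s) ≡ (p +ₚ (r +ₚ s))
+ₚ-assoc []      r       s       = refl
+ₚ-assoc (a ∷ p) []      s       = refl
+ₚ-assoc (a ∷ p) (b ∷ r) []      = refl
+ₚ-assoc (a ∷ p) (b ∷ r) (c ∷ s) = cong₂ _∷_ (ℤ.+-assoc a b c) (+ₚ-assoc p r s)

+ₚ-isCommutativeMonoid : IsCommutativeMonoid _≋_ _+ₚ_ 0ₚ
+ₚ-isCommutativeMonoid = record
  { isMonoid = record
    { isSemigroup = record
      { isMagma = record
        { isEquivalence = ≋.isEquivalence
        ; ∙-cong        = +ₚ-cong
        }
      ; assoc = λ p r s → ≋.reflexive (+ₚ-assoc p r s)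
      }
    ; identity = (λ _ → ≋.refl) , (λ p → ≋.reflexive (+ₚ-identityʳ p))
    }
  ; comm = λ p r → ≋.reflexive (+ₚ-comm p r)
  }

+ₚ-commutativeSemigroup : CommutativeSemigroup 0ℓ 0ℓ
+ₚ-commutativeSemigroup = record
  { isCommutativeSemigroup = IsCommutativeMonoid.isCommutativeSemigroup +ₚ-isCommutativeMonoid }

private
  module +ₚ = CommutativeSemigroupProperties +ₚ-commutativeSemigroup

scale-zeroˡ : ∀ p → scale 0ℤ p ≋ 0ₚ
scale-zeroˡ p .at k = coeff-scale 0ℤ p k

scale-cong : ∀ a {p r} → p ≋ r → scale a p ≋ scale a r
scale-cong a {p} {r} e .at k = begin
  coeff (scale a p) k ≡⟨ coeff-scale a p k ⟩
  a ℤ.* coeff p k     ≡⟨ cong (a ℤ.*_) (e .at k) ⟩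
  a ℤ.* coeff r k     ≡⟨ coeff-scale a r k ⟨
  coeff (scale a r) k ∎
  where open ≡-Reasoning

scale-distribˡ : ∀ a p r → scale a (p +ₚ r) ≡ (scale a p +ₚ scale a r)
scale-distribˡ a []      r       = refl
scale-distribˡ a (b ∷ p) []      = refl
scale-distribˡ a (b ∷ p) (c ∷ r) = cong₂ _∷_ (ℤ.*-distribˡ-+ a b c) (scale-distribˡ a p r)

scale-distribʳ : ∀ a b p → scale (a ℤ.+ b) p ≡ (scale a p +ₚ scale b p)
scale-distribʳ a b []      = refl
scale-distribʳ a b (c ∷ p) = cong₂ _∷_ (ℤ.*-distribʳ-+ c a b) (scale-distribʳ a b p)

scale-scale : ∀ a b p → scale (a ℤ.* b) p ≡ scale a (scale b p)
scale-scale a b p = trans (map-cong (ℤ.*-assoc a b) p) (map-∘ p)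

*ₚ-zeroʳ : ∀ p → (p *ₚ 0ₚ) ≋ 0ₚ
*ₚ-zeroʳ []      = ≋.refl
*ₚ-zeroʳ (a ∷ p) = ≋.trans (∷-cong refl (*ₚ-zeroʳ p)) 0∷[]≋0ₚ

*ₚ-congˡ : ∀ p {r s} → r ≋ s → (p *ₚ r) ≋ (p *ₚ s)
*ₚ-congˡ []      e = ≋.refl
*ₚ-congˡ (a ∷ p) {r} {s} e =
  +ₚ-cong (scale-cong a e) (∷-cong refl (*ₚ-congˡ p e))

-- The mirror image of the defining clause of `_*ₚ_`, which recurses on the left factor;
-- commutativity then follows by induction on that factor.
*ₚ-∷ʳ : ∀ p b r → (p *ₚ (b ∷ r)) ≋ (scale b p +ₚ (0ℤ ∷ (p *ₚ r)))
*ₚ-∷ʳ []      b r = ≋.sym 0∷[]≋0ₚ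
*ₚ-∷ʳ (a ∷ p) b r = ∷-cong (cong (ℤ._+ 0ℤ) (ℤ.*-comm a b)) (begin
  scale a r +ₚ (p *ₚ (b ∷ r))                    ≈⟨ +ₚ-cong ≋.refl (*ₚ-∷ʳ p b r) ⟩
  scale a r +ₚ (scale b p +ₚ (0ℤ ∷ (p *ₚ r)))    ≈⟨ +ₚ.x∙yz≈y∙xz (scale a r) (scale b p) _ ⟩
  scale b p +ₚ (scale a r +ₚ (0ℤ ∷ (p *ₚ r)))    ∎)
  where open ≋-Reasoning

*ₚ-comm : ∀ p r → (p *ₚ r) ≋ (r *ₚ p)
*ₚ-comm []      r = ≋.sym (*ₚ-zeroʳ r)
*ₚ-comm (a ∷ p) r = begin
  scale a r +ₚ (0ℤ ∷ (p *ₚ r)) ≈⟨ +ₚ-cong ≋.refl (∷-cong refl (*ₚ-comm p r)) ⟩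
  scale a r +ₚ (0ℤ ∷ (r *ₚ p)) ≈⟨ *ₚ-∷ʳ r a p ⟨
  r *ₚ (a ∷ p)                 ∎
  where open ≋-Reasoning

*ₚ-cong : ∀ {p p′ r r′} → p ≋ p′ → r ≋ r′ → (p *ₚ r) ≋ (p′ *ₚ r′)
*ₚ-cong {p} {p′} {r} {r′} e f = begin
  p *ₚ r    ≈⟨ *ₚ-congˡ p f ⟩
  p *ₚ r′   ≈⟨ *ₚ-comm p r′ ⟩
  r′ *ₚ p   ≈⟨ *ₚ-congˡ r′ e ⟩
  r′ *ₚ p′  ≈⟨ *ₚ-comm r′ p′ ⟩
  p′ *ₚ r′  ∎
  where open ≋-Reasoning

*ₚ-distribʳ : ∀ s p r → ((p +ₚ r) *ₚ s) ≋ ((p *ₚ s) +ₚ (r *ₚ s))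
*ₚ-distribʳ s []      r       = ≋.refl
*ₚ-distribʳ s (a ∷ p) []      = ≋.reflexive (sym (+ₚ-identityʳ ((a ∷ p) *ₚ s)))
*ₚ-distribʳ s (a ∷ p) (b ∷ r) = begin
  scale (a ℤ.+ b) s +ₚ (0ℤ ∷ ((p +ₚ r) *ₚ s))
    ≈⟨ +ₚ-cong (≋.reflexive (scale-distribʳ a b s)) (∷-cong refl (*ₚ-distribʳ s p r)) ⟩
  (scale a s +ₚ scale b s) +ₚ ((0ℤ ∷ (p *ₚ s)) +ₚ (0ℤ ∷ (r *ₚ s)))
    ≈⟨ +ₚ.interchange (scale a s) (scale b s) _ _ ⟩
  ((a ∷ p) *ₚ s) +ₚ ((b ∷ r) *ₚ s)
    ∎
  where open ≋-Reasoning

scale-*ₚ : ∀ a p r → (scale a p *ₚ r) ≋ scale a (p *ₚ r)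
scale-*ₚ a []      r = ≋.refl
scale-*ₚ a (b ∷ p) r = begin
  scale (a ℤ.* b) r +ₚ (0ℤ ∷ (scale a p *ₚ r))
    ≈⟨ +ₚ-cong (≋.reflexive (scale-scale a b r)) (∷-cong (sym (ℤ.*-zeroʳ a)) (scale-*ₚ a p r)) ⟩
  scale a (scale b r) +ₚ scale a (0ℤ ∷ (p *ₚ r))
    ≡⟨ scale-distribˡ a (scale b r) _ ⟨
  scale a ((b ∷ p) *ₚ r)
    ∎
  where open ≋-Reasoning

*ₚ-assoc : ∀ p r s → ((p *ₚ r) *ₚ s) ≋ (p *ₚ (r *ₚ s))
*ₚ-assoc []      r s = ≋.refl
*ₚ-assoc (a ∷ p) r s = begin
  (scale a r +ₚ (0ℤ ∷ (p *ₚ r))) *ₚ s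
    ≈⟨ *ₚ-distribʳ s (scale a r) _ ⟩
  -- The shifted summand has leading coefficient zero, so its product with `s` starts with the
  -- vanishing term `scale 0ℤ s`.
  (scale a r *ₚ s) +ₚ (scale 0ℤ s +ₚ (0ℤ ∷ ((p *ₚ r) *ₚ s)))
    ≈⟨ +ₚ-cong (scale-*ₚ a r s) (+ₚ-cong (scale-zeroˡ s) (∷-cong refl (*ₚ-assoc p r s))) ⟩
  scale a (r *ₚ s) +ₚ (0ℤ ∷ (p *ₚ (r *ₚ s)))
    ∎
  where open ≋-Reasoning

const-*ₚ : ∀ a p → (const a *ₚ p) ≋ scale a p
const-*ₚ a p = begin
  scale a p +ₚ (0ℤ ∷ []) ≈⟨ +ₚ-cong ≋.refl 0∷[]≋0ₚ ⟩
  scale a p +ₚ 0ₚ        ≡⟨ +ₚ-identityʳ (scale a p) ⟩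
  scale a p              ∎
  where open ≋-Reasoning

*ₚ-identityˡ : ∀ p → (1ₚ *ₚ p) ≋ p
*ₚ-identityˡ p = begin
  1ₚ *ₚ p    ≈⟨ const-*ₚ 1ℤ p ⟩
  scale 1ℤ p ≡⟨ map-cong ℤ.*-identityˡ p ⟩
  map id p   ≡⟨ map-id p ⟩
  p          ∎
  where open ≋-Reasoning

ℤ[q]-commutativeSemiring : CommutativeSemiring 0ℓ 0ℓ
ℤ[q]-commutativeSemiring = record
  { 1# = 1ₚ
  ; isCommutativeSemiring = isCommutativeSemiringˡ record
    { +-isCommutativeMonoid = +ₚ-isCommutativeMonoid
    ; *-isCommutativeMonoid = isCommutativeMonoidˡ record
      { isSemigroup = record
        { isMagma = record
          { isEquivalence = ≋.isEquivalence
          ; ∙-cong        = *ₚ-cong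
          }
        ; assoc = *ₚ-assoc
        }
      ; identityˡ = *ₚ-identityˡ
      ; comm      = *ₚ-comm
      }
    ; distribʳ = *ₚ-distribʳ
    ; zeroˡ    = λ _ → ≋.refl
    }
  }

private
  module *ₚ = CommutativeSemigroupProperties
    (CommutativeSemiring.*-commutativeSemigroup ℤ[q]-commutativeSemiring)

-- Lists and the order on `Fin`

private
  variable
    X Y : Set
    n : ℕ

filter-map : {P : Pred Y 0ℓ} (P? : Decidable P) (f : X → Y) (xs : List X) →
             filter P? (map f xs) ≡ map f (filter (P? ∘ f) xs)
filter-map P? f []       = refl
filter-map P? f (x ∷ xs) with does (P? (f x))
... | true  = cong (f x ∷_) (filter-map P? f xs)
... | false = filter-map P? f xs

-- Splits off the last index, so that in `A-suc` the maximal first entry can be separated from the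
-- middle ones.
tabulate-∷ʳ : (f : Fin (suc n) → X) → tabulate f ≡ tabulate (f ∘ inject₁) ∷ʳ f (fromℕ n)
tabulate-∷ʳ {n = zero}  f = refl
tabulate-∷ʳ {n = suc n} f = cong (f 0F ∷_) (tabulate-∷ʳ (f ∘ Fin.suc))

allFin-suc : ∀ n → allFin (suc n) ≡ 0F ∷ map Fin.suc (allFin n)
allFin-suc n = cong (0F ∷_) (sym (map-tabulate id Fin.suc))

punchIn-mono-< : ∀ i {j k : Fin n} → j Fin.< k → punchIn i j Fin.< punchIn i k
punchIn-mono-< i {j} {k} j<k =
  Fin.≤∧≢⇒< (Fin.punchIn-mono-≤ i j k (<⇒≤ j<k))
            (Fin.<⇒≢ j<k ∘ Fin.punchIn-injective i j k)

punchIn-cancel-< : ∀ i {j k : Fin n} → punchIn i j Fin.< punchIn i k → j Fin.< k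
punchIn-cancel-< i {j} {k} lt =
  Fin.≤∧≢⇒< (Fin.punchIn-cancel-≤ i j k (<⇒≤ lt)) (Fin.<⇒≢ lt ∘ cong (punchIn i))

-- Making room at the top value moves no other value, so all of them stay below it.
punchIn-fromℕ-< : ∀ (k : Fin n) → punchIn (fromℕ n) k Fin.< fromℕ n
punchIn-fromℕ-< 0F          = z<s
punchIn-fromℕ-< (Fin.suc k) = s<s (punchIn-fromℕ-< k)

-- Pattern avoidance

-- One configuration for both patterns: the order of `j` and `k` is left open, and `j` before `k`
-- gives 213 while `k` before `j` gives 231.
Straddles : Permutation′ n → Set
Straddles {n} π = ∃ λ (i : Fin n) → ∃ λ j → ∃ λ k →
  i Fin.< j × i Fin.< k × (π ⟨$⟩ʳ j) Fin.< (π ⟨$⟩ʳ i) × (π ⟨$⟩ʳ i) Fin.< (π ⟨$⟩ʳ k)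

-- One direction of the order equivalence is enough. The values of `τ` are distinct and linearly
-- ordered, so if `τ` did not increase from `a` to `b`, then either `a` and `b` coincide or `mono`
-- reverses the assumed inequality.
isOccurrence⁺ : ∀ {k} (τ : Permutation′ k) (π : Permutation′ n) {is : Vec (Fin n) k} →
  Linked Fin._<_ is →
  (∀ a b → (τ ⟨$⟩ʳ a) Fin.< (τ ⟨$⟩ʳ b) → (π ⟨$⟩ʳ lookup is a) Fin.< (π ⟨$⟩ʳ lookup is b)) →
  IsOccurrence τ π is
isOccurrence⁺ τ π {is} linked mono = linked , λ a b → mk⇔ (reflect a b) (mono a b)
  where
  τ-injective : ∀ {a b} → τ ⟨$⟩ʳ a ≡ τ ⟨$⟩ʳ b → a ≡ b
  τ-injective e = trans (sym (inverseˡ τ)) (trans (cong (τ ⟨$⟩ˡ_) e) (inverseˡ τ))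

  reflect : ∀ a b → (π ⟨$⟩ʳ lookup is a) Fin.< (π ⟨$⟩ʳ lookup is b) → (τ ⟨$⟩ʳ a) Fin.< (τ ⟨$⟩ʳ b)
  reflect a b lt with Fin.<-cmp (τ ⟨$⟩ʳ a) (τ ⟨$⟩ʳ b)
  ... | tri< τa<τb _ _ = τa<τb
  ... | tri≈ _ τa≡τb _ =
    contradiction (cong (λ c → π ⟨$⟩ʳ lookup is c) (τ-injective τa≡τb)) (Fin.<⇒≢ lt)
  ... | tri> _ _ τb<τa = contradiction (mono b a τb<τa) (Fin.<-asym lt)

AvoidsBoth : Permutation′ n → Set
AvoidsBoth π = Avoids π [213] × Avoids π [231]

avoidsBoth? : Decidable (AvoidsBoth {n})
avoidsBoth? π = avoids? π [213] ×-dec avoids? π [231]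

avoidsBoth⇒¬straddles : (π : Permutation′ n) → AvoidsBoth π → ¬ Straddles π
avoidsBoth⇒¬straddles π (¬213 , ¬231) (i , j , k , i<j , i<k , πj<πi , πi<πk)
  with Fin.<-cmp j k
... | tri< j<k _ _ = ¬213 (i ∷ j ∷ k ∷ [] , isOccurrence⁺ [213] π (i<j ∷ j<k ∷ [-]) λ where
  0F 2F _ → πi<πk
  1F 0F _ → πj<πi
  1F 2F _ → Fin.<-trans πj<πi πi<πk
  0F 0F (s≤s ())
  1F 1F ()
  2F 1F ()
  2F 0F (s≤s ())
  2F 2F (s≤s (s≤s ())))
... | tri≈ _ refl _ = Fin.<-asym πj<πi πi<πk
... | tri> _ _ k<j = ¬231 (i ∷ k ∷ j ∷ [] , isOccurrence⁺ [231] π (i<k ∷ k<j ∷ [-]) λ where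
  0F 1F _ → πi<πk
  2F 0F _ → πj<πi
  2F 1F _ → Fin.<-trans πj<πi πi<πk
  0F 0F (s≤s ())
  1F 0F (s≤s ())
  1F 1F (s≤s (s≤s ()))
  0F 2F ()
  1F 2F ()
  2F 2F ())

¬straddles⇒avoidsBoth : (π : Permutation′ n) → ¬ Straddles π → AvoidsBoth π
¬straddles⇒avoidsBoth π ¬s =
    -- Both 213 and 231 begin with their middle value, so the first position of an occurrence is the
    -- straddled one.
    (λ { (i ∷ j ∷ k ∷ [] , i<j ∷ j<k ∷ _ , iso) →
         ¬s (i , j , k , i<j , Fin.<-trans i<j j<k ,
             Equivalence.from (iso 1F 0F) z<s , Equivalence.from (iso 0F 2F) (s<s z<s)) })
  , (λ { (i ∷ k ∷ j ∷ [] , i<k ∷ k<j ∷ _ , iso) →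
         ¬s (i , j , k , Fin.<-trans i<k k<j , i<k ,
             Equivalence.from (iso 2F 0F) z<s , Equivalence.from (iso 0F 1F) (s<s z<s)) })

straddles-insert : ∀ j (π : Permutation′ n) → Straddles π → Straddles (insert 0F j π)
straddles-insert j π (a , b , c , a<b , a<c , πb<πa , πa<πc) =
  Fin.suc a , Fin.suc b , Fin.suc c , s<s a<b , s<s a<c ,
  punchIn-mono-< j πb<πa , punchIn-mono-< j πa<πc

-- A minimal first entry has nothing below it and a maximal one nothing above it, so the straddled
-- entry lies in the tail, where `punchIn j` reflects the order.
straddles-uninsert : ∀ j (π : Permutation′ n) → j ≡ 0F ⊎ j ≡ fromℕ n →
                     Straddles (insert 0F j π) → Straddles π
straddles-uninsert j π extreme (Fin.suc a , Fin.suc b , Fin.suc c , a<b , a<c , lt , lt′) =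
  a , b , c , s<s⁻¹ a<b , s<s⁻¹ a<c , punchIn-cancel-< j lt , punchIn-cancel-< j lt′
straddles-uninsert j π (inj₁ refl) (0F , Fin.suc b , Fin.suc c , _ , _ , () , _)
straddles-uninsert j π (inj₂ refl) (0F , Fin.suc b , Fin.suc c , _ , _ , _ , lt) =
  contradiction lt (Fin.<-asym (punchIn-fromℕ-< (π ⟨$⟩ʳ c)))

insert-middle-straddles : ∀ {j} (π : Permutation′ n) → Fin.zero {n} Fin.< j → j Fin.< fromℕ n →
                          Straddles (insert 0F j π)
insert-middle-straddles {n} {j} π 0<j j<n =
  -- The witnesses are the positions of the least and the greatest value. Both come after the first
  -- position, because the entry `j` there is neither of the two values.
  0F , ρ ⟨$⟩ˡ 0F , ρ ⟨$⟩ˡ fromℕ n , later 0F (Fin.<⇒≢ 0<j ∘ sym) , later (fromℕ n) (Fin.<⇒≢ j<n) ,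
  subst (Fin._< j) (sym (inverseʳ ρ)) 0<j , subst (j Fin.<_) (sym (inverseʳ ρ)) j<n
  where
  ρ = insert 0F j π

  later : ∀ v → j ≢ v → Fin.zero {n} Fin.< (ρ ⟨$⟩ˡ v)
  later v j≢v with ρ ⟨$⟩ˡ v in eq
  ... | 0F        = contradiction (trans (cong (ρ ⟨$⟩ʳ_) (sym eq)) (inverseʳ ρ)) j≢v
  ... | Fin.suc _ = z<s

avoidsBoth-insert : ∀ {j} → j ≡ 0F ⊎ j ≡ fromℕ n → AvoidsBoth ∘ insert 0F j ≐ AvoidsBoth
avoidsBoth-insert {j = j} extreme =
    (λ {π} av → ¬straddles⇒avoidsBoth π
       (avoidsBoth⇒¬straddles (insert 0F j π) av ∘ straddles-insert j π))
  , (λ {π} av → ¬straddles⇒avoidsBoth (insert 0F j π)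
       (avoidsBoth⇒¬straddles π av ∘ straddles-uninsert j π extreme))

filter-insert : ∀ {j} → j ≡ 0F ⊎ j ≡ fromℕ n → (πs : List (Permutation′ n)) →
  filter avoidsBoth? (map (insert 0F j) πs) ≡ map (insert 0F j) (filter avoidsBoth? πs)
filter-insert {j = j} extreme πs = trans (filter-map avoidsBoth? (insert 0F j) πs)
  (cong (map (insert 0F j))
    (filter-≐ (avoidsBoth? ∘ insert 0F j) avoidsBoth? (avoidsBoth-insert extreme) πs))

-- The list of permutations is grouped by first entry. Middle entries straddle and are filtered out,
-- while for the two extreme entries filtering commutes with insertion. The size is at least two, so
-- the minimum and the maximum are different first entries.
A-suc : ∀ n → A (2 + n) ≡
  map (insert 0F 0F) (A (1 + n)) ++ map (insert 0F (fromℕ (1 + n))) (A (1 + n))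
A-suc n = begin
  filter avoidsBoth? (ins 0F ++ block (tabulate Fin.suc))
    ≡⟨ cong (λ js → filter avoidsBoth? (ins 0F ++ block js)) (tabulate-∷ʳ Fin.suc) ⟩
  filter avoidsBoth? (ins 0F ++ block (middle ∷ʳ last))
    ≡⟨ filter-++ avoidsBoth? (ins 0F) _ ⟩
  filter avoidsBoth? (ins 0F) ++ filter avoidsBoth? (block (middle ∷ʳ last))
    ≡⟨ cong₂ _++_ (filter-insert (inj₁ refl) πs) tail-block ⟩
  map (insert 0F 0F) (A (1 + n)) ++ map (insert 0F last) (A (1 + n)) ∎
  where
  open ≡-Reasoning
  πs     = permutations (1 + n)
  last   = fromℕ (1 + n)
  middle = tabulate (Fin.suc ∘ inject₁)

  ins : Fin (2 + n) → List (Permutation′ (2 + n))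
  ins j = map (insert 0F j) πs

  block : List (Fin (2 + n)) → List (Permutation′ (2 + n))
  block js = cartesianProductWith (insert 0F) js πs

  middle-straddles : ∀ {j π} → j ∈ middle → π ∈ πs → ¬ AvoidsBoth (insert 0F j π)
  middle-straddles {π = π} j∈ _ av with ∈-tabulate⁻ j∈
  ... | i , refl = avoidsBoth⇒¬straddles (insert 0F (Fin.suc (inject₁ i)) π) av
    (insert-middle-straddles π z<s (s<s (subst (_< toℕ (fromℕ n)) (sym (Fin.toℕ-inject₁ i))
      (subst (toℕ i <_) (sym (Fin.toℕ-fromℕ n)) (Fin.toℕ<n i)))))

  tail-block : filter avoidsBoth? (block (middle ∷ʳ last)) ≡ map (insert 0F last) (A (1 + n))
  tail-block = begin
    filter avoidsBoth? (block (middle ∷ʳ last))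
      ≡⟨ cong (filter avoidsBoth?) (cartesianProductWith-distribʳ-++ (insert 0F) middle (last ∷ []) πs) ⟩
    filter avoidsBoth? (block middle ++ (ins last ++ []))
      ≡⟨ filter-++ avoidsBoth? (block middle) _ ⟩
    filter avoidsBoth? (block middle) ++ filter avoidsBoth? (ins last ++ [])
      ≡⟨ cong₂ _++_
           (filter-none avoidsBoth?
             (All.cartesianProductWith⁺ (setoid _) (setoid _) (insert 0F) middle πs middle-straddles))
           (cong (filter avoidsBoth?) (++-identityʳ (ins last))) ⟩
    filter avoidsBoth? (ins last)
      ≡⟨ filter-insert (inj₂ refl) πs ⟩
    map (insert 0F last) (A (1 + n)) ∎

-- Sign

count : {P : Pred X 0ℓ} → Decidable P → List X → ℕ
count P? xs = length (filter P? xs)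

count-map : {P : Pred Y 0ℓ} (P? : Decidable P) (f : X → Y) (xs : List X) →
            count P? (map f xs) ≡ count (P? ∘ f) xs
count-map P? f xs = trans (cong length (filter-map P? f xs)) (length-map f (filter (P? ∘ f) xs))

count-++ : {P : Pred X 0ℓ} (P? : Decidable P) (xs ys : List X) →
           count P? (xs ++ ys) ≡ count P? xs + count P? ys
count-++ P? xs ys = trans (cong length (filter-++ P? xs ys)) (length-++ (filter P? xs))

count-≐ : {P Q : Pred X 0ℓ} (P? : Decidable P) (Q? : Decidable Q) → P ≐ Q →
          ∀ xs → count P? xs ≡ count Q? xs
count-≐ P? Q? P≐Q xs = cong length (filter-≐ P? Q? P≐Q xs)

inverted? : (π : Permutation′ n) →
  Decidable (uncurry λ i j → i Fin.< j × (π ⟨$⟩ʳ j) Fin.< (π ⟨$⟩ʳ i))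
inverted? π (i , j) = (i Fin.<? j) ×-dec ((π ⟨$⟩ʳ j) Fin.<? (π ⟨$⟩ʳ i))

-- Pairs are split by their first position. The first entry is inverted with exactly the later
-- values below `j`; the other inversions are those of `π`, since `punchIn j` preserves and reflects
-- the order.
length-inversions-insert : ∀ j (π : Permutation′ n) →
  length (inversions (insert 0F j π)) ≡
  count (λ k → punchIn j (π ⟨$⟩ʳ k) Fin.<? j) (allFin n) + length (inversions π)
length-inversions-insert {n} j π = begin
  count inv (cartesianProduct (allFin (suc n)) (allFin (suc n)))
    ≡⟨ cong (λ L → count inv (cartesianProduct L L)) (allFin-suc n) ⟩
  -- The pair `(0F , 0F)` has already been discarded by evaluation.
  count inv (map (0F ,_) (map Fin.suc (allFin n)) ++
             cartesianProduct (map Fin.suc (allFin n)) (0F ∷ map Fin.suc (allFin n)))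
    ≡⟨ count-++ inv (map (0F ,_) (map Fin.suc (allFin n))) _ ⟩
  count inv (map (0F ,_) (map Fin.suc (allFin n))) +
  count inv (cartesianProduct (map Fin.suc (allFin n)) (0F ∷ map Fin.suc (allFin n)))
    ≡⟨ cong₂ _+_ first (rest (allFin n)) ⟩
  count (λ k → punchIn j (π ⟨$⟩ʳ k) Fin.<? j) (allFin n) + length (inversions π) ∎
  where
  open ≡-Reasoning
  inv = inverted? (insert 0F j π)

  first : count inv (map (0F ,_) (map Fin.suc (allFin n))) ≡
          count (λ k → punchIn j (π ⟨$⟩ʳ k) Fin.<? j) (allFin n)
  first = begin
    count inv (map (0F ,_) (map Fin.suc (allFin n)))
      ≡⟨ cong (count inv) (map-∘ (allFin n)) ⟨
    count inv (map (λ k → 0F , Fin.suc k) (allFin n))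
      ≡⟨ count-map inv _ (allFin n) ⟩
    count (λ k → inv (0F , Fin.suc k)) (allFin n)
      ≡⟨ count-≐ _ _ (proj₂ , (z<s ,_)) (allFin n) ⟩
    count (λ k → punchIn j (π ⟨$⟩ʳ k) Fin.<? j) (allFin n) ∎

  row : ∀ i ks → count inv (map (Fin.suc i ,_) (map Fin.suc ks)) ≡
                 count (inverted? π) (map (i ,_) ks)
  row i ks = begin
    count inv (map (Fin.suc i ,_) (map Fin.suc ks))
      ≡⟨ cong (count inv) (map-∘ ks) ⟨
    count inv (map (λ k → Fin.suc i , Fin.suc k) ks)
      ≡⟨ count-map inv _ ks ⟩
    count (λ k → inv (Fin.suc i , Fin.suc k)) ks
      ≡⟨ count-≐ _ _ ( (λ (i<k , lt) → s<s⁻¹ i<k , punchIn-cancel-< j lt)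
                     , (λ (i<k , lt) → s<s i<k , punchIn-mono-< j lt)) ks ⟩
    count (λ k → inverted? π (i , k)) ks
      ≡⟨ count-map (inverted? π) _ ks ⟨
    count (inverted? π) (map (i ,_) ks) ∎

  rest : ∀ is → count inv (cartesianProduct (map Fin.suc is) (0F ∷ map Fin.suc (allFin n))) ≡
                count (inverted? π) (cartesianProduct is (allFin n))
  rest []       = refl
  -- The pair `(Fin.suc i , 0F)` has its positions in the wrong order and is discarded by
  -- evaluation.
  rest (i ∷ is) = begin
    count inv (map (Fin.suc i ,_) (map Fin.suc (allFin n)) ++
               cartesianProduct (map Fin.suc is) (0F ∷ map Fin.suc (allFin n)))
      ≡⟨ count-++ inv (map (Fin.suc i ,_) (map Fin.suc (allFin n))) _ ⟩
    _ ≡⟨ cong₂ _+_ (row i (allFin n)) (rest is) ⟩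
    _ ≡⟨ count-++ (inverted? π) (map (i ,_) (allFin n)) _ ⟨
    count (inverted? π) (cartesianProduct (i ∷ is) (allFin n)) ∎

sign-insert-first : (π : Permutation′ n) → sign (insert 0F 0F π) ≡ sign π
sign-insert-first {n} π = cong (-1ℤ ℤ.^_) (trans (length-inversions-insert 0F π)
  (cong (_+ length (inversions π))
    (cong length (filter-none (λ k → Fin.suc (π ⟨$⟩ʳ k) Fin.<? Fin.zero {n}) (All.universal (λ _ ()) (allFin n))))))

-- All `n` later entries lie below the maximum, so prepending it creates `n` new inversions.
sign-insert-last : (π : Permutation′ n) → sign (insert 0F (fromℕ n) π) ≡ -1ℤ ℤ.^ n ℤ.* sign π
sign-insert-last {n} π = begin
  -1ℤ ℤ.^ length (inversions (insert 0F (fromℕ n) π))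
    ≡⟨ cong (-1ℤ ℤ.^_) (length-inversions-insert (fromℕ n) π) ⟩
  -1ℤ ℤ.^ (count below? (allFin n) + length (inversions π))
    ≡⟨ cong (λ m → -1ℤ ℤ.^ (m + length (inversions π))) all-below ⟩
  -1ℤ ℤ.^ (n + length (inversions π))
    ≡⟨ ℤ.^-distribˡ-+-* -1ℤ n _ ⟩
  -1ℤ ℤ.^ n ℤ.* sign π ∎
  where
  open ≡-Reasoning
  below? = λ k → punchIn (fromℕ n) (π ⟨$⟩ʳ k) Fin.<? fromℕ n

  all-below : count below? (allFin n) ≡ n
  all-below = trans
    (cong length (filter-all below? (All.universal (λ k → punchIn-fromℕ-< (π ⟨$⟩ʳ k)) (allFin n))))
    (length-tabulate {n = n} id)

-- Longest increasing subsequence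

increasing? : Decidable (AllPairs (Fin._<_ {n}))
increasing? = allPairs? Fin._<?_

-- The list whose maximum is `lis`, stated for arbitrary lists of values so that the effect of a new
-- first entry can be computed without permutations.
increasingLengths : List (Fin n) → List ℕ
increasingLengths xs = map length (filter increasing? (subsequences xs))

oneLine-insert : ∀ j (π : Permutation′ n) → oneLine (insert 0F j π) ≡ j ∷ map (punchIn j) (oneLine π)
oneLine-insert {n} j π = cong (j ∷_) (begin
  map (insert 0F j π ⟨$⟩ʳ_) (tabulate Fin.suc)  ≡⟨ map-tabulate Fin.suc _ ⟩
  tabulate (λ k → punchIn j (π ⟨$⟩ʳ k))         ≡⟨ map-tabulate (π ⟨$⟩ʳ_) (punchIn j) ⟨
  map (punchIn j) (tabulate (π ⟨$⟩ʳ_))          ≡⟨ cong (map (punchIn j)) (map-tabulate id (π ⟨$⟩ʳ_)) ⟨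
  map (punchIn j) (oneLine π)                   ∎)
  where open ≡-Reasoning

subsequences-map : (f : X → Y) (xs : List X) →
                   subsequences (map f xs) ≡ map (map f) (subsequences xs)
subsequences-map f []       = refl
subsequences-map f (x ∷ xs) = begin
  map (f x ∷_) (subsequences (map f xs)) ++ subsequences (map f xs)
    ≡⟨ cong (λ S → map (f x ∷_) S ++ S) (subsequences-map f xs) ⟩
  map (f x ∷_) (map (map f) S) ++ map (map f) S
    ≡⟨ cong (_++ map (map f) S) (trans (sym (map-∘ S)) (map-∘ S)) ⟩
  map (map f) (map (x ∷_) S) ++ map (map f) S
    ≡⟨ map-++ (map f) (map (x ∷_) S) S ⟨
  map (map f) (subsequences (x ∷ xs)) ∎
  where
  open ≡-Reasoning
  S = subsequences xs

increasing-punchIn : ∀ (j : Fin (suc n)) → AllPairs Fin._<_ ∘ map (punchIn j) ≐ AllPairs Fin._<_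
increasing-punchIn j =
    (λ inc → AllPairs.map (punchIn-cancel-< j) (AllPairs.map⁻ inc))
  , (λ inc → AllPairs.map⁺ (AllPairs.map (punchIn-mono-< j) inc))

increasingLengths-punchIn : ∀ j (xs : List (Fin n)) →
                            increasingLengths (map (punchIn j) xs) ≡ increasingLengths xs
increasingLengths-punchIn j xs = begin
  map length (filter increasing? (subsequences (map (punchIn j) xs)))
    ≡⟨ cong (map length ∘ filter increasing?) (subsequences-map (punchIn j) xs) ⟩
  map length (filter increasing? (map (map (punchIn j)) (subsequences xs)))
    ≡⟨ cong (map length) (filter-map increasing? (map (punchIn j)) (subsequences xs)) ⟩
  map length (map (map (punchIn j)) (filter (increasing? ∘ map (punchIn j)) (subsequences xs)))
    ≡⟨ map-∘ _ ⟨
  map (length ∘ map (punchIn j)) (filter (increasing? ∘ map (punchIn j)) (subsequences xs))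
    ≡⟨ map-cong (length-map (punchIn j)) _ ⟩
  map length (filter (increasing? ∘ map (punchIn j)) (subsequences xs))
    ≡⟨ cong (map length) (filter-≐ (increasing? ∘ map (punchIn j)) increasing? (increasing-punchIn j) (subsequences xs)) ⟩
  increasingLengths xs ∎
  where open ≡-Reasoning

-- Separates the increasing subsequences that use `j` from those that do not. The latter keep their
-- lengths under `punchIn j`; which of the former are increasing depends on `j` and stays as a
-- filter.
increasingLengths-∷ : ∀ j (xs : List (Fin n)) →
  increasingLengths (j ∷ map (punchIn j) xs) ≡
  map (suc ∘ length) (filter (λ l → increasing? (j ∷ map (punchIn j) l)) (subsequences xs))
  ++ increasingLengths xs
increasingLengths-∷ j xs = begin
  map length (filter increasing? (map (j ∷_) S ++ S))
    ≡⟨ cong (map length) (filter-++ increasing? (map (j ∷_) S) S) ⟩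
  map length (filter increasing? (map (j ∷_) S) ++ filter increasing? S)
    ≡⟨ map-++ length (filter increasing? (map (j ∷_) S)) _ ⟩
  map length (filter increasing? (map (j ∷_) S)) ++ increasingLengths (map (punchIn j) xs)
    ≡⟨ cong₂ _++_ front (increasingLengths-punchIn j xs) ⟩
  map (suc ∘ length) T ++ increasingLengths xs ∎
  where
  open ≡-Reasoning
  S = subsequences (map (punchIn j) xs)
  g = λ l → j ∷ map (punchIn j) l
  T = filter (increasing? ∘ g) (subsequences xs)

  front : map length (filter increasing? (map (j ∷_) S)) ≡ map (suc ∘ length) T
  front = begin
    map length (filter increasing? (map (j ∷_) S))
      ≡⟨ cong (λ U → map length (filter increasing? (map (j ∷_) U))) (subsequences-map (punchIn j) xs) ⟩
    map length (filter increasing? (map (j ∷_) (map (map (punchIn j)) (subsequences xs))))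
      ≡⟨ cong (map length ∘ filter increasing?) (map-∘ (subsequences xs)) ⟨
    map length (filter increasing? (map g (subsequences xs)))
      ≡⟨ cong (map length) (filter-map increasing? g (subsequences xs)) ⟩
    map length (map g T)
      ≡⟨ map-∘ T ⟨
    map (length ∘ g) T
      ≡⟨ map-cong (cong suc ∘ length-map (punchIn j)) T ⟩
    map (suc ∘ length) T ∎

[]∈subsequences : (xs : List X) → [] ∈ subsequences xs
[]∈subsequences []       = here refl
[]∈subsequences (x ∷ xs) = ∈-++⁺ʳ (map (x ∷_) (subsequences xs)) ([]∈subsequences xs)

0∈increasingLengths : (xs : List (Fin n)) → 0 ∈ increasingLengths xs
0∈increasingLengths xs = ∈-map⁺ length (∈-filter⁺ increasing? ([]∈subsequences xs) [])

1∈increasingLengths : ∀ x (xs : List (Fin n)) → 1 ∈ increasingLengths (x ∷ xs)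
1∈increasingLengths x xs = ∈-map⁺ length
  (∈-filter⁺ increasing? (∈-++⁺ˡ (∈-map⁺ (x ∷_) ([]∈subsequences xs))) ([] ∷ []))

-- The default value 0 of `max` is itself attained, by the empty subsequence.
max∈increasingLengths : (xs : List (Fin n)) → max 0 (increasingLengths xs) ∈ increasingLengths xs
max∈increasingLengths xs with argmax-sel id 0 (increasingLengths xs)
... | inj₁ max≡0 = subst (_∈ increasingLengths xs) (sym max≡0) (0∈increasingLengths xs)
... | inj₂ max∈  = max∈

-- The minimum can be put in front of every increasing subsequence of the tail, so each old length
-- also occurs raised by one.
lis-insert-first : (π : Permutation′ n) → lis (insert 0F 0F π) ≡ suc (lis π)
lis-insert-first π = begin
  max 0 (increasingLengths (oneLine (insert 0F 0F π)))
    ≡⟨ cong (max 0 ∘ increasingLengths) (oneLine-insert 0F π) ⟩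
  max 0 (increasingLengths (0F ∷ map Fin.suc (oneLine π)))
    ≡⟨ cong (max 0) (increasingLengths-∷ 0F (oneLine π)) ⟩
  max 0 (map (suc ∘ length) (filter 0∷increasing? (subsequences (oneLine π))) ++ L)
    ≡⟨ cong (λ l → max 0 (map (suc ∘ length) l ++ L)) (filter-≐ 0∷increasing? increasing? prepend (subsequences (oneLine π))) ⟩
  max 0 (map (suc ∘ length) (filter increasing? (subsequences (oneLine π))) ++ L)
    ≡⟨ cong (λ l → max 0 (l ++ L)) (map-∘ (filter increasing? (subsequences (oneLine π)))) ⟩
  max 0 (map suc L ++ L)
    ≡⟨ max≈v⁺ (∈-++⁺ˡ (∈-map⁺ suc (max∈increasingLengths (oneLine π))))
         (All.++⁺ (All.map⁺ (All.map s≤s (xs≤max 0 L))) (All.map m≤n⇒m≤1+n (xs≤max 0 L))) z≤n ⟩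
  suc (max 0 L) ∎
  where
  open ≡-Reasoning
  L = increasingLengths (oneLine π)
  0∷increasing? = λ l → increasing? (0F ∷ map Fin.suc l)

  prepend : (λ l → AllPairs Fin._<_ (0F ∷ map Fin.suc l)) ≐ AllPairs Fin._<_
  prepend = (λ { (_ ∷ inc) → proj₁ (increasing-punchIn 0F) inc })
          , (λ {l} inc → All.map⁺ (All.universal (λ _ → z<s) l) ∷ proj₂ (increasing-punchIn 0F) inc)

-- Nothing can follow the maximum in an increasing subsequence, so those that use it have length
-- one. The tail already attains that length because `π` is nonempty.
lis-insert-last : (π : Permutation′ (suc n)) → lis (insert 0F (fromℕ (suc n)) π) ≡ lis π
lis-insert-last {n} π = begin
  max 0 (increasingLengths (oneLine (insert 0F last π)))
    ≡⟨ cong (max 0 ∘ increasingLengths) (oneLine-insert last π) ⟩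
  max 0 (increasingLengths (last ∷ map (punchIn last) (oneLine π)))
    ≡⟨ cong (max 0) (increasingLengths-∷ last (oneLine π)) ⟩
  max 0 (map (suc ∘ length) (filter last∷increasing? (subsequences (oneLine π))) ++ L)
    ≡⟨ max≈v⁺ (∈-++⁺ʳ (map (suc ∘ length) T) (max∈increasingLengths (oneLine π)))
         (All.++⁺ (All.map⁺ (All.map (λ {l} inc → ≤-trans (short l inc) 1≤lis)
                              (All.all-filter last∷increasing? (subsequences (oneLine π)))))
                  (xs≤max 0 L))
         z≤n ⟩
  max 0 L ∎
  where
  open ≡-Reasoning
  last = fromℕ (suc n)
  L = increasingLengths (oneLine π)
  last∷increasing? = λ l → increasing? (last ∷ map (punchIn last) l)
  T = filter last∷increasing? (subsequences (oneLine π))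

  1≤lis : 1 ≤ lis π
  1≤lis = All.lookup (xs≤max 0 L) (1∈increasingLengths (π ⟨$⟩ʳ 0F) (map (π ⟨$⟩ʳ_) (tabulate Fin.suc)))

  short : ∀ l → AllPairs Fin._<_ (last ∷ map (punchIn last) l) → suc (length l) ≤ 1
  short []      _                = ≤-refl
  short (x ∷ _) ((last<x ∷ _) ∷ _) = contradiction last<x (Fin.<-asym (punchIn-fromℕ-< x))

-- The recursion

weight : Permutation′ n → Poly
weight π = const (sign π) *ₚ q ^ₚ lis π

weight-insert-first : (π : Permutation′ n) → weight (insert 0F 0F π) ≋ q *ₚ weight π
weight-insert-first π = begin
  weight (insert 0F 0F π)                  ≡⟨ cong₂ (λ s l → const s *ₚ q ^ₚ l) (sign-insert-first π) (lis-insert-first π) ⟩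
  const (sign π) *ₚ (q *ₚ q ^ₚ lis π)      ≈⟨ *ₚ.x∙yz≈y∙xz (const (sign π)) q _ ⟩
  q *ₚ weight π                            ∎
  where open ≋-Reasoning

weight-insert-last : (π : Permutation′ (suc n)) →
  weight (insert 0F (fromℕ (suc n)) π) ≋ const (-1ℤ ℤ.^ suc n) *ₚ weight π
weight-insert-last {n} π = begin
  weight (insert 0F (fromℕ (suc n)) π)
    ≡⟨ cong₂ (λ s l → const s *ₚ q ^ₚ l) (sign-insert-last π) (lis-insert-last π) ⟩
  const (ε ℤ.* sign π) *ₚ q ^ₚ lis π
    ≈⟨ *ₚ-cong (const-*ₚ ε (const (sign π))) ≋.refl ⟨
  (const ε *ₚ const (sign π)) *ₚ q ^ₚ lis π
    ≈⟨ *ₚ-assoc (const ε) (const (sign π)) _ ⟩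
  const ε *ₚ weight π ∎
  where
  open ≋-Reasoning
  ε = -1ℤ ℤ.^ suc n

∑ₚ-++ : (xs ys : List X) (f : X → Poly) → ∑ₚ (xs ++ ys) f ≡ ∑ₚ xs f +ₚ ∑ₚ ys f
∑ₚ-++ []       ys f = refl
∑ₚ-++ (x ∷ xs) ys f = trans (cong (f x +ₚ_) (∑ₚ-++ xs ys f)) (sym (+ₚ-assoc (f x) _ _))

∑ₚ-map-scaled : (g : X → Y) (f : Y → Poly) (h : X → Poly) (c : Poly) →
  (∀ x → f (g x) ≋ c *ₚ h x) → ∀ xs → ∑ₚ (map g xs) f ≋ c *ₚ ∑ₚ xs h
∑ₚ-map-scaled g f h c e []       = ≋.sym (*ₚ-zeroʳ c)
∑ₚ-map-scaled g f h c e (x ∷ xs) = begin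
  f (g x) +ₚ ∑ₚ (map g xs) f       ≈⟨ +ₚ-cong (e x) (∑ₚ-map-scaled g f h c e xs) ⟩
  c *ₚ h x +ₚ c *ₚ ∑ₚ xs h         ≈⟨ CommutativeSemiring.distribˡ ℤ[q]-commutativeSemiring c (h x) _ ⟨
  c *ₚ ∑ₚ (x ∷ xs) h               ∎
  where open ≋-Reasoning

∑-weight-insert : (πs : List (Permutation′ (suc n))) →
  ∑ₚ (map (insert 0F 0F) πs ++ map (insert 0F (fromℕ (suc n))) πs) weight ≋
  (q +ₚ const (-1ℤ ℤ.^ suc n)) *ₚ ∑ₚ πs weight
∑-weight-insert {n} πs = begin
  ∑ₚ (map first πs ++ map last πs) weight
    ≡⟨ ∑ₚ-++ (map first πs) (map last πs) weight ⟩
  ∑ₚ (map first πs) weight +ₚ ∑ₚ (map last πs) weight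
    ≈⟨ +ₚ-cong (∑ₚ-map-scaled first weight weight q weight-insert-first πs)
               (∑ₚ-map-scaled last weight weight (const ε) weight-insert-last πs) ⟩
  q *ₚ ∑ₚ πs weight +ₚ const ε *ₚ ∑ₚ πs weight
    ≈⟨ *ₚ-distribʳ (∑ₚ πs weight) q (const ε) ⟨
  (q +ₚ const ε) *ₚ ∑ₚ πs weight ∎
  where
  open ≋-Reasoning
  ε = -1ℤ ℤ.^ suc n
  first = insert 0F 0F
  last = insert 0F (fromℕ (suc n))

∑-weight-suc : ∀ n →
  ∑ₚ (A (2 + n)) weight ≋ (q +ₚ const (-1ℤ ℤ.^ suc n)) *ₚ ∑ₚ (A (1 + n)) weight
∑-weight-suc n = ≋.trans
  (≋.reflexive (cong (λ πs → ∑ₚ πs weight) (A-suc n))) (∑-weight-insert (A (1 + n)))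

-- The closed form

[-1]^[m*2]≡1 : ∀ m → -1ℤ ℤ.^ (m * 2) ≡ 1ℤ
[-1]^[m*2]≡1 zero    = refl
[-1]^[m*2]≡1 (suc m) = cong (λ s → -1ℤ ℤ.* (-1ℤ ℤ.* s)) ([-1]^[m*2]≡1 m)

closedForm : ℕ → ℕ → Poly
closedForm a b = q *ₚ (q +ₚ 1ₚ) ^ₚ a *ₚ (q -ₚ 1ₚ) ^ₚ b

closedForm-sucˡ : ∀ a b → (q +ₚ 1ₚ) *ₚ closedForm a b ≋ closedForm (suc a) b
closedForm-sucˡ a b = begin
  (q +ₚ 1ₚ) *ₚ (q *ₚ S *ₚ T)     ≈⟨ *ₚ-assoc (q +ₚ 1ₚ) (q *ₚ S) T ⟨
  (q +ₚ 1ₚ) *ₚ (q *ₚ S) *ₚ T     ≈⟨ *ₚ-cong (*ₚ.x∙yz≈y∙xz (q +ₚ 1ₚ) q S) ≋.refl ⟩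
  q *ₚ ((q +ₚ 1ₚ) *ₚ S) *ₚ T     ∎
  where
  open ≋-Reasoning
  S = (q +ₚ 1ₚ) ^ₚ a
  T = (q -ₚ 1ₚ) ^ₚ b

closedForm-sucʳ : ∀ a b → (q -ₚ 1ₚ) *ₚ closedForm a b ≋ closedForm a (suc b)
closedForm-sucʳ a b = *ₚ.x∙yz≈y∙xz (q -ₚ 1ₚ) (q *ₚ (q +ₚ 1ₚ) ^ₚ a) ((q -ₚ 1ₚ) ^ₚ b)

-- The names refer to the parity of the size. Passing from size `1 + m * 2` to `2 + m * 2` involves
-- an odd power of -1 and so contributes the factor `q -ₚ 1ₚ`.
∑-weight-even : ∀ m → ∑ₚ (A (1 + m * 2)) weight ≋ closedForm m m →
                ∑ₚ (A (2 + m * 2)) weight ≋ closedForm m (suc m)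
∑-weight-even m ih = begin
  ∑ₚ (A (2 + m * 2)) weight
    ≈⟨ ∑-weight-suc (m * 2) ⟩
  (q +ₚ const (-1ℤ ℤ.* -1ℤ ℤ.^ (m * 2))) *ₚ ∑ₚ (A (1 + m * 2)) weight
    -- After the rewriting, the first factor evaluates to the same list as `q -ₚ 1ₚ`.
    ≈⟨ *ₚ-cong (≋.reflexive (cong (λ s → q +ₚ const (-1ℤ ℤ.* s)) ([-1]^[m*2]≡1 m))) ih ⟩
  (q -ₚ 1ₚ) *ₚ closedForm m m
    ≈⟨ closedForm-sucʳ m m ⟩
  closedForm m (suc m) ∎
  where open ≋-Reasoning

∑-weight-odd : ∀ m → ∑ₚ (A (1 + m * 2)) weight ≋ closedForm m m
∑-weight-odd zero    = evaluate
  where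
  evaluate : ∑ₚ (A 1) weight ≋ closedForm 0 0
  -- For size one both sides are `q`, compared by evaluating coefficients.
  evaluate .at 0                   = refl
  evaluate .at 1                   = refl
  evaluate .at 2                   = refl
  evaluate .at (suc (suc (suc _))) = refl
∑-weight-odd (suc m) = begin
  ∑ₚ (A (3 + m * 2)) weight
    ≈⟨ ∑-weight-suc (1 + m * 2) ⟩
  (q +ₚ const (-1ℤ ℤ.^ (suc m * 2))) *ₚ ∑ₚ (A (2 + m * 2)) weight
    ≈⟨ *ₚ-cong (≋.reflexive (cong (λ s → q +ₚ const s) ([-1]^[m*2]≡1 (suc m))))
               (∑-weight-even m (∑-weight-odd m)) ⟩
  (q +ₚ 1ₚ) *ₚ closedForm m (suc m)
    ≈⟨ closedForm-sucˡ m (suc m) ⟩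
  closedForm (suc m) (suc m) ∎
  where open ≋-Reasoning

[m*2]/2≡m : ∀ m → m * 2 / 2 ≡ m
[m*2]/2≡m m = m*n/n≡m m 2

[1+m*2]/2≡m : ∀ m → (1 + m * 2) / 2 ≡ m
[1+m*2]/2≡m m = trans (+-distrib-/-∣ʳ 1 {d = 2} (divides-refl m)) (m*n/n≡m m 2)

[2+m*2]/2≡1+m : ∀ m → (2 + m * 2) / 2 ≡ suc m
[2+m*2]/2≡1+m m = m*n/n≡m (suc m) 2

parity : ∀ n → ∃ λ m → n ≡ m * 2 ⊎ n ≡ 1 + m * 2
parity n with n divMod 2
... | result m 0F n≡m*2   = m , inj₁ n≡m*2
... | result m 1F n≡1+m*2 = m , inj₂ n≡1+m*2

-- Here `n` is one less than the size, so the two quotients are the exponents required for size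
-- `suc n`.
∑-weight-parity : ∀ {n} m → n ≡ m * 2 ⊎ n ≡ 1 + m * 2 →
                  ∑ₚ (A (suc n)) weight ≋ closedForm (n / 2) (suc n / 2)
∑-weight-parity m (inj₁ refl) = ≋.trans (∑-weight-odd m)
  (≋.reflexive (sym (cong₂ closedForm ([m*2]/2≡m m) ([1+m*2]/2≡m m))))
∑-weight-parity m (inj₂ refl) = ≋.trans (∑-weight-even m (∑-weight-odd m))
  (≋.reflexive (sym (cong₂ closedForm ([1+m*2]/2≡m m) ([2+m*2]/2≡1+m m))))

-- Even and odd permutations

[-1]^n≡±1 : ∀ n → -1ℤ ℤ.^ n ≡ 1ℤ ⊎ -1ℤ ℤ.^ n ≡ -1ℤ
[-1]^n≡±1 zero    = inj₁ refl
[-1]^n≡±1 (suc n) with [-1]^n≡±1 n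
... | inj₁ e = inj₂ (cong (-1ℤ ℤ.*_) e)
... | inj₂ e = inj₁ (cong (-1ℤ ℤ.*_) e)

sign-insert-last-even : -1ℤ ℤ.^ n ≡ 1ℤ → (π : Permutation′ n) →
                        sign (insert 0F (fromℕ n) π) ≡ sign π
sign-insert-last-even e π =
  trans (sign-insert-last π) (trans (cong (ℤ._* sign π) e) (ℤ.*-identityˡ _))

sign-insert-last-odd : -1ℤ ℤ.^ n ≡ -1ℤ → (π : Permutation′ n) →
                       sign (insert 0F (fromℕ n) π) ≡ ℤ.- sign π
sign-insert-last-odd e π =
  trans (sign-insert-last π) (trans (cong (ℤ._* sign π) e) (ℤ.-1*i≡-i _))

-- `P` and `Q` describe what `R` demands of the tail below a minimum and below a maximum. Keeping
-- them separate covers both the sign-preserving and the sign-reversing case.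
count-A-suc : ∀ {P Q : Pred (Permutation′ (1 + n)) 0ℓ} {R : Pred (Permutation′ (2 + n)) 0ℓ}
  (P? : Decidable P) (Q? : Decidable Q) (R? : Decidable R) →
  R ∘ insert 0F 0F ≐ P → R ∘ insert 0F (fromℕ (1 + n)) ≐ Q →
  count R? (A (2 + n)) ≡ count P? (A (1 + n)) + count Q? (A (1 + n))
count-A-suc {n} P? Q? R? R≐P R≐Q = begin
  count R? (A (2 + n))
    ≡⟨ cong (count R?) (A-suc n) ⟩
  count R? (map (insert 0F 0F) (A (1 + n)) ++ map (insert 0F (fromℕ (1 + n))) (A (1 + n)))
    ≡⟨ count-++ R? (map (insert 0F 0F) (A (1 + n))) _ ⟩
  count R? (map (insert 0F 0F) (A (1 + n))) + count R? (map (insert 0F (fromℕ (1 + n))) (A (1 + n)))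
    ≡⟨ cong₂ _+_ (trans (count-map R? _ (A (1 + n))) (count-≐ _ P? R≐P (A (1 + n))))
                 (trans (count-map R? _ (A (1 + n))) (count-≐ _ Q? R≐Q (A (1 + n)))) ⟩
  count P? (A (1 + n)) + count Q? (A (1 + n)) ∎
  where open ≡-Reasoning

first-preserves : ∀ s → (λ (π : Permutation′ n) → sign (insert 0F 0F π) ≡ s) ≐ (λ π → sign π ≡ s)
first-preserves s = (λ {π} → trans (sym (sign-insert-first π))) , (λ {π} → trans (sign-insert-first π))

-- The maximum reverses the sign, so even and odd elements of the smaller set enter both counts,
-- only in the opposite order.
balanced-suc-odd : ∀ n → -1ℤ ℤ.^ (1 + n) ≡ -1ℤ → count even? (A (2 + n)) ≡ count odd? (A (2 + n))
balanced-suc-odd n e = begin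
  count even? (A (2 + n))
    ≡⟨ count-A-suc even? odd? even? (first-preserves 1ℤ) (flips 1ℤ -1ℤ refl) ⟩
  count even? (A (1 + n)) + count odd? (A (1 + n))
    ≡⟨ +-comm (count even? (A (1 + n))) _ ⟩
  count odd? (A (1 + n)) + count even? (A (1 + n))
    ≡⟨ count-A-suc odd? even? odd? (first-preserves -1ℤ) (flips -1ℤ 1ℤ refl) ⟨
  count odd? (A (2 + n)) ∎
  where
  open ≡-Reasoning

  flips : ∀ s t → s ≡ ℤ.- t →
    (λ (π : Permutation′ (1 + n)) → sign (insert 0F (fromℕ (1 + n)) π) ≡ s) ≐ (λ π → sign π ≡ t)
  flips s t s≡-t =
      (λ {π} eq → ℤ.neg-injective (trans (sym (sign-insert-last-odd e π)) (trans eq s≡-t)))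
    , (λ {π} eq → trans (sign-insert-last-odd e π) (trans (cong ℤ.-_ eq) (sym s≡-t)))

balanced-suc-even : ∀ n → -1ℤ ℤ.^ (1 + n) ≡ 1ℤ → count even? (A (1 + n)) ≡ count odd? (A (1 + n)) →
                    count even? (A (2 + n)) ≡ count odd? (A (2 + n))
balanced-suc-even n e ih = begin
  count even? (A (2 + n))
    ≡⟨ count-A-suc even? even? even? (first-preserves 1ℤ) (preserves 1ℤ) ⟩
  count even? (A (1 + n)) + count even? (A (1 + n))
    ≡⟨ cong₂ _+_ ih ih ⟩
  count odd? (A (1 + n)) + count odd? (A (1 + n))
    ≡⟨ count-A-suc odd? odd? odd? (first-preserves -1ℤ) (preserves -1ℤ) ⟨
  count odd? (A (2 + n)) ∎
  where
  open ≡-Reasoning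

  preserves : ∀ s →
    (λ (π : Permutation′ (1 + n)) → sign (insert 0F (fromℕ (1 + n)) π) ≡ s) ≐ (λ π → sign π ≡ s)
  preserves s = (λ {π} → trans (sym (sign-insert-last-even e π)))
              , (λ {π} → trans (sign-insert-last-even e π))

-- The induction starts at size two, since the only permutation of size one is even. Size two comes
-- from the odd power `-1ℤ ℤ.^ 1`; afterwards the sign of the power selects the case.
balanced : ∀ n → count even? (A (2 + n)) ≡ count odd? (A (2 + n))
balanced zero    = balanced-suc-odd 0 refl
balanced (suc n) =
  [ (λ e → balanced-suc-even (1 + n) e (balanced n)) , balanced-suc-odd (1 + n) ]′ ([-1]^n≡±1 (2 + n))

corollary5p3 : ∀ (n : ℕ) → 1 ≤ n →
    (∑ₚ (A n) (λ π → const (sign π) *ₚ q ^ₚ lis π)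
    ≈ₚ q *ₚ (q +ₚ 1ₚ) ^ₚ ((n ∸ 1) / 2) *ₚ (q -ₚ 1ₚ) ^ₚ (n / 2))
    × (2 ≤ n → length (filter even? (A n)) ≡ length (filter odd? (A n)))
corollary5p3 (suc n) _ = uncurry ∑-weight-parity (parity n) .at , λ { (s≤s (s≤s {n = m} z≤n)) → balanced m }
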